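{- For all integers $n$ and $k$ with $n\ge 2k$, $$\min(n-2k+2,\lfloor n/2\rfloor)\le \chi(U(n,k))\le \min(n-2k+2,\lceil n/2\rceil).$$
   Context: For integers $n$ and $k$ with $n\ge 2k$, $U(n,k)$ is the graph whose vertices are the $k$-subsets of $[n]=\{1,\ldots,n\}$ that include a pair of elements that are consecutive modulo $n$ (i.e., contain $\{j,j+1\}$ for some $1\le j<n$, or contain $\{1,n\}$), with two sets adjacent if and only if they are disjoint. $\chi(G)$ denotes the chromatic number of a graph $G$.
   Formalization: The lower bound is stated only for k ≥ 2: for k ≤ 1 the graph U(n,k) has no vertices, so its chromatic number is 0 and the printed lower bound fails (e.g. n = 2, k = 1); n and k are taken to be nonnegative. -}

module Defs where

open import Data.Bool using (true; false)
open import Data.Fin using (Fin; toℕ; finToFun; funToFin)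
open import Data.Fin.Properties using (any?; all?; finToFun-funToFin)
  renaming (_≟_ to _≟ᶠ_)
open import Data.Fin.Subset using (Subset; Empty; _∈_; _∩_; ∣_∣)
open import Data.Fin.Subset.Properties using (_∈?_; nonempty?; ∩-comm; x∈p∩q⁺)
open import Data.Irrelevant using ([_])
open import Data.List using (List; []; _∷_; _++_; length; lookup; map)
open import Data.List.Membership.Propositional using () renaming (_∈_ to _∈ᴸ_)
open import Data.List.Membership.Propositional.Properties
  using (∈-map⁺; ∈-++⁺ˡ; ∈-++⁺ʳ)
open import Data.List.Relation.Unary.Any using (here; there; index)
open import Data.List.Relation.Unary.Any.Properties using (lookup-index)
open import Data.Nat using (ℕ; zero; suc; _≤_; z≤n; s≤s; _≟_)
open import Data.Product using (Σ; ∃; ∃₂; _×_; _,_; proj₁)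
open import Data.Refinement using (Refinement-syntax; value; _,_)
open import Data.Sum using (_⊎_; inj₁; inj₂)
open import Data.Vec using ([]; _∷_)
open import Function using (_∘_)
open import Relation.Binary using (Rel; Decidable; Symmetric)
open import Relation.Binary.PropositionalEquality
  using (_≡_; _≢_; refl; sym; trans; cong; subst; subst₂)
open import Relation.Nullary
  using (¬_; Dec; yes; no; ¬?; _×-dec_; _⊎-dec_; _→-dec_; contradiction; recompute)
open import Relation.Nullary.Decidable using (map′)
open import Relation.Unary using (Pred) renaming (Decidable to Decidable₁)
open import Level using (0ℓ)

-- Finite simple graphs. Finiteness and decidable adjacency are carried as data
-- so that the chromatic number is a computable function; repetitions in
-- `vertices` are harmless.

record FiniteGraph : Set₁ where
  infix 4 _~_ _~?_
  field
    V        : Set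
    _~_      : Rel V 0ℓ
    ~-sym    : Symmetric _~_
    ~-irrefl : ∀ {v} → ¬ (v ~ v)
    _~?_     : Decidable _~_
    vertices : List V
    complete : ∀ v → v ∈ᴸ vertices

Colorable : FiniteGraph → ℕ → Set
Colorable G m = Σ (V → Fin m) λ c → ∀ {u v} → u ~ v → c u ≢ c v
  where open FiniteGraph G

module _ (G : FiniteGraph) where
  open FiniteGraph G

  private
    N : ℕ
    N = length vertices

    vertex : Fin N → V
    vertex = lookup vertices

    position : V → Fin N
    position v = index (complete v)

    vertex-position : ∀ v → v ≡ vertex (position v)
    vertex-position v = lookup-index (complete v)

    ProperCode : ∀ m → Pred (Fin N → Fin m) 0ℓ
    ProperCode m f = ∀ i j → vertex i ~ vertex j → f i ≢ f j

    properCode? : ∀ m → Decidable₁ (ProperCode m)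
    properCode? m f =
      all? λ i → all? λ j → (vertex i ~? vertex j) →-dec ¬? (f i ≟ᶠ f j)

  colorable? : ∀ m → Dec (Colorable G m)
  colorable? m = map′ to from (any? (properCode? m ∘ finToFun))
    where
    to : ∃ (ProperCode m ∘ finToFun) → Colorable G m
    to (e , proper) = finToFun e ∘ position , λ {u} {v} u~v →
      proper (position u) (position v)
        (subst₂ _~_ (vertex-position u) (vertex-position v) u~v)

    from : Colorable G m → ∃ (ProperCode m ∘ finToFun)
    from (c , proper) = funToFin (c ∘ vertex) , λ i j i~j eq →
      proper i~j (trans (sym (finToFun-funToFin (c ∘ vertex) i))
                 (trans eq (finToFun-funToFin (c ∘ vertex) j)))

  colorable-by-position : Colorable G N
  colorable-by-position = position , λ {u} {v} u~v eq →
    ~-irrefl (subst (u ~_) (trans (vertex-position v)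
      (trans (cong vertex (sym eq)) (sym (vertex-position u)))) u~v)

Least : (ℕ → Set) → ℕ → Set
Least P m = P m × (∀ l → P l → m ≤ l)

least : ∀ {P : ℕ → Set} → Decidable₁ P → ∀ n → P n → ∃ (Least P)
least P? zero    p = zero , p , λ _ _ → z≤n
least {P} P? (suc n) p with P? zero
... | yes p₀ = zero , p₀ , λ _ _ → z≤n
... | no ¬p₀ with least {P ∘ suc} (P? ∘ suc) n p
...   | m , pm , min = suc m , pm , λ
  { zero    p₀ → contradiction p₀ ¬p₀
  ; (suc l) pl → s≤s (min l pl) }

chromaticNumber : ∀ G → ∃ (Least (Colorable G))
chromaticNumber G = least (colorable? G) _ (colorable-by-position G)

χ : FiniteGraph → ℕ
χ G = proj₁ (chromaticNumber G)

-- Here and below, i : Fin n stands for the element toℕ i + 1 of {1,…,n}.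
-- The second disjunct is the pair {1 , n}.

Consecutive : ∀ {n} → Rel (Fin n) 0ℓ
Consecutive {n} i j =
  (toℕ j ≡ suc (toℕ i)) ⊎ (toℕ i ≡ 0 × suc (toℕ j) ≡ n)

ContainsConsecutive : ∀ {n} → Pred (Subset n) 0ℓ
ContainsConsecutive s = ∃₂ λ i j → i ∈ s × j ∈ s × Consecutive i j

IsVertex : ∀ n k → Pred (Subset n) 0ℓ
IsVertex n k s = ∣ s ∣ ≡ k × ContainsConsecutive s

isVertex? : ∀ n k → Decidable₁ (IsVertex n k)
isVertex? n k s = (∣ s ∣ ≟ k) ×-dec
  any? λ i → any? λ j → (i ∈? s) ×-dec (j ∈? s) ×-dec
    ((toℕ j ≟ suc (toℕ i)) ⊎-dec ((toℕ i ≟ 0) ×-dec (suc (toℕ j) ≟ n)))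

Disjoint : ∀ {n} → Rel (Subset n) 0ℓ
Disjoint s t = Empty (s ∩ t)

subsets : ∀ n → List (Subset n)
subsets zero    = [] ∷ []
subsets (suc n) = map (true ∷_) (subsets n) ++ map (false ∷_) (subsets n)

∈-subsets : ∀ {n} (s : Subset n) → s ∈ᴸ subsets n
∈-subsets []          = here refl
∈-subsets (true  ∷ s) = ∈-++⁺ˡ (∈-map⁺ (true ∷_) (∈-subsets s))
∈-subsets (false ∷ s) =
  ∈-++⁺ʳ (map (true ∷_) (subsets _)) (∈-map⁺ (false ∷_) (∈-subsets s))

refineAll : ∀ {A : Set} {P : Pred A 0ℓ} → Decidable₁ P → List A → List [ x ∈ A ∣ P x ]
refineAll P? []       = []
refineAll P? (x ∷ xs) with P? x
... | yes p = (x , [ p ]) ∷ refineAll P? xs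
... | no  _ = refineAll P? xs

∈-refineAll : ∀ {A : Set} {P : Pred A 0ℓ} (P? : Decidable₁ P) {xs}
              (v : [ x ∈ A ∣ P x ]) → value v ∈ᴸ xs → v ∈ᴸ refineAll P? xs
∈-refineAll P? {x ∷ xs} (.x , [ p ]) (here refl) with P? x
... | yes _ = here refl
... | no ¬p = contradiction (recompute (P? x) p) ¬p
∈-refineAll P? {x ∷ xs} v (there v∈) with P? x
... | yes _ = there (∈-refineAll P? v v∈)
... | no  _ = ∈-refineAll P? v v∈

-- The refinement makes the proof of IsVertex irrelevant, so a set containing
-- several consecutive pairs is still a single vertex.

U : ℕ → ℕ → FiniteGraph
U n k = record
  { V        = [ s ∈ Subset n ∣ IsVertex n k s ]
  ; _~_      = λ s t → Disjoint (value s) (value t)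
  ; ~-sym    = λ {s} {t} → subst Empty (∩-comm (value s) (value t))
  ; ~-irrefl = λ {s} → irrefl s
  ; _~?_     = λ s t → ¬? (nonempty? (value s ∩ value t))
  ; vertices = refineAll (isVertex? n k) (subsets n)
  ; complete = λ v → ∈-refineAll (isVertex? n k) v (∈-subsets (value v))
  }
  where
  irrefl : (s : [ s ∈ Subset n ∣ IsVertex n k s ]) → ¬ Disjoint (value s) (value s)
  irrefl (s , [ v ]) s∩s=∅ with recompute (isVertex? n k s) v
  ... | _ , i , _ , i∈s , _ = s∩s=∅ (i , x∈p∩q⁺ (i∈s , i∈s))

{-# OPTIONS --safe #-}
module Submission where

-- Lower bound.  Given an m-colouring, let R = max (2k − 2) ⌈n/2⌉; we show n ≤ R + m by
-- Tucker's lemma for sign vectors x ∈ {+,−,0}ⁿ.  A vector one of whose sides contains a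
-- vertex is labelled by the largest such colour, shifted by R; any other vector by the
-- length r of a longest alternating subsequence of ((−1)ⁱ xᵢ), capped at R.  The cap is
-- never active: if r > R, take the sign c occurring at least as often as the other one
-- in such a subsequence, so that side c has at least r/2 > k − 1 elements.  If side c
-- has no two cyclically consecutive elements, the distance from one term of the
-- subsequence to the next is at least 1, 2 or 3 according to how many of the two have
-- sign c; adding up, 2r ≤ n + 1, contrary to r > R.
--
-- Upper bounds.  Colour a vertex by an element of a vertex cover of the n-cycle it
-- contains, or by an element among the first n − 2k + 1, with one more colour for the
-- subsets of the last 2k − 1 elements.

open import Algebra.Bundles using (CommutativeRing)
open import Data.Bool as Bool using (Bool; true; false; not; _∧_; _xor_; if_then_else_)
open import Data.Bool.Properties
  using (xor-same; xor-identityʳ; xor-comm; xor-∧-commutativeRing; ∧-distribʳ-xor;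
         ∧-zeroʳ; ∧-identityʳ; not-involutive; ¬-not; T-≡)
open import Data.Fin as Fin using (Fin; toℕ; fromℕ<)
open import Data.Fin.Properties using (toℕ<n; toℕ-injective; any?; fromℕ<-injective)
open import Data.Fin.Subset using (Subset; _∈_; _⊆_; ∣_∣; ⁅_⁆; _∪_)
open import Data.Fin.Subset.Properties
open import Data.Irrelevant using ([_])
open import Data.List as List using (List; filter)
open import Data.List.Extrema.Nat using (max; argmax-sel; xs≤max; max-mono-⊆)
open import Data.List.Membership.Propositional using () renaming (_∈_ to _∈ᴸ_)
open import Data.List.Membership.Propositional.Properties
  using (∈-map⁺; ∈-map⁻; ∈-filter⁺; ∈-filter⁻)
open import Data.List.Relation.Binary.Subset.Propositional.Properties
  using (filter⁺′; map⁺)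
import Data.List.Relation.Unary.All as All
open import Data.Maybe as Maybe using (Maybe; just; nothing)
open import Data.Nat
open import Data.Nat.Properties
open import Data.Nat.Tactic.RingSolver using (solve-∀)
open import Data.Product using (∃; ∃₂; _×_; _,_; proj₁; proj₂)
open import Data.Refinement using (value; _,_)
open import Data.Sum as Sum using (_⊎_; inj₁; inj₂; [_,_]′)
open import Data.Vec as Vec using (Vec; []; _∷_; here; there)
open import Function using (_∘_; id; Equivalence)
open import Relation.Binary.PropositionalEquality
open import Relation.Nullary using (¬_; yes; no; contradiction; recompute; _×-dec_)

open import Defs

open import Algebra.Properties.CommutativeSemigroup
  (CommutativeRing.+-commutativeSemigroup xor-∧-commutativeRing)
  using () renaming (interchange to xor-interchange)

-- Tucker's lemma: faces of the cross-polytope and sums modulo 2.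

SignVec : ℕ → Set
SignVec = Vec (Maybe Bool)

neg : ∀ {n} → SignVec n → SignVec n
neg = Vec.map (Maybe.map not)

-- The covering relation of the face poset of the cross-polytope, with the zero vector as the empty
-- face: y is a facet of x.
infix 4 _⋖_
data _⋖_ : ∀ {n} → SignVec n → SignVec n → Set where
  drop : ∀ {n b} {x : SignVec n} → (nothing ∷ x) ⋖ (just b ∷ x)
  keep : ∀ {n c} {x y : SignVec n} → y ⋖ x → (c ∷ y) ⋖ (c ∷ x)

-- The sum modulo 2 of f over the y ⋖ x.
∂ : ∀ {n} → (SignVec n → Bool) → SignVec n → Bool
∂ f []            = false
∂ f (nothing ∷ x) = ∂ (f ∘ (nothing ∷_)) x
∂ f (just b ∷ x)  = f (nothing ∷ x) xor ∂ (f ∘ (just b ∷_)) x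

∂-cong : ∀ {n} {f g : SignVec n → Bool} → f ≗ g → ∂ f ≗ ∂ g
∂-cong f≗g []            = refl
∂-cong f≗g (nothing ∷ x) = ∂-cong (f≗g ∘ (nothing ∷_)) x
∂-cong f≗g (just b ∷ x)  = cong₂ _xor_ (f≗g _) (∂-cong (f≗g ∘ (just b ∷_)) x)

∂-xor : ∀ {n} (f g : SignVec n → Bool) x →
        ∂ (λ y → f y xor g y) x ≡ ∂ f x xor ∂ g x
∂-xor f g []            = refl
∂-xor f g (nothing ∷ x) = ∂-xor (f ∘ (nothing ∷_)) (g ∘ (nothing ∷_)) x
∂-xor f g (just b ∷ x)  = trans
  (cong ((f (nothing ∷ x) xor g (nothing ∷ x)) xor_)
    (∂-xor (f ∘ (just b ∷_)) (g ∘ (just b ∷_)) x))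
  (xor-interchange (f (nothing ∷ x)) (g (nothing ∷ x))
    (∂ (f ∘ (just b ∷_)) x) (∂ (g ∘ (just b ∷_)) x))

-- Two entries can be erased in either order, so every vector two steps below x is counted twice.
∂-∂ : ∀ {n} (f : SignVec n → Bool) x → ∂ (∂ f) x ≡ false
∂-∂ f []            = refl
∂-∂ f (nothing ∷ x) = ∂-∂ (f ∘ (nothing ∷_)) x
∂-∂ f (just b ∷ x)  = begin
  s xor ∂ (λ y → f (nothing ∷ y) xor ∂ (f ∘ (just b ∷_)) y) x
    ≡⟨ cong (s xor_) (∂-xor (f ∘ (nothing ∷_)) (∂ (f ∘ (just b ∷_))) x) ⟩
  s xor (s xor ∂ (∂ (f ∘ (just b ∷_))) x)
    ≡⟨ cong (λ t → s xor (s xor t)) (∂-∂ (f ∘ (just b ∷_)) x) ⟩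
  s xor (s xor false)
    ≡⟨ cong (s xor_) (xor-identityʳ s) ⟩
  s xor s
    ≡⟨ xor-same s ⟩
  false ∎
  where
  open ≡-Reasoning
  s = ∂ (f ∘ (nothing ∷_)) x

∂-neg : ∀ {n} (f : SignVec n → Bool) x → ∂ f (neg x) ≡ ∂ (f ∘ neg) x
∂-neg f []            = refl
∂-neg f (nothing ∷ x) = ∂-neg (f ∘ (nothing ∷_)) x
∂-neg f (just b ∷ x)  = cong (f (nothing ∷ neg x) xor_) (∂-neg (f ∘ (just (not b) ∷_)) x)

∂-true⇒⋖ : ∀ {n} (f : SignVec n → Bool) x → ∂ f x ≡ true →
           ∃ λ y → y ⋖ x × f y ≡ true
∂-true⇒⋖ f (nothing ∷ x) eq =
  let y , y⋖x , fy = ∂-true⇒⋖ (f ∘ (nothing ∷_)) x eq in _ , keep y⋖x , fy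
∂-true⇒⋖ f (just b ∷ x) eq with f (nothing ∷ x) in fx
... | true  = _ , drop , fx
... | false =
  let y , y⋖x , fy = ∂-true⇒⋖ (f ∘ (just b ∷_)) x eq in _ , keep y⋖x , fy

-- The sum modulo 2 over the vectors without zero entries.
total : ∀ {n} → (SignVec n → Bool) → Bool
total {zero}  f = f []
total {suc n} f = total (f ∘ (just true ∷_)) xor total (f ∘ (just false ∷_))

total-cong : ∀ {n} {f g : SignVec n → Bool} → f ≗ g → total f ≡ total g
total-cong {zero}  f≗g = f≗g []
total-cong {suc n} f≗g =
  cong₂ _xor_ (total-cong (f≗g ∘ (just true ∷_))) (total-cong (f≗g ∘ (just false ∷_)))

total-xor : ∀ {n} (f g : SignVec n → Bool) →
            total (λ x → f x xor g x) ≡ total f xor total g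
total-xor {zero}  f g = refl
total-xor {suc n} f g = trans
  (cong₂ _xor_ (total-xor (f ∘ (just true ∷_)) (g ∘ (just true ∷_)))
               (total-xor (f ∘ (just false ∷_)) (g ∘ (just false ∷_))))
  (xor-interchange (total (f ∘ (just true ∷_))) (total (g ∘ (just true ∷_))) _ _)

total-neg : ∀ {n} (f : SignVec n → Bool) → total (f ∘ neg) ≡ total f
total-neg {zero}  f = refl
total-neg {suc n} f = trans
  (cong₂ _xor_ (total-neg (f ∘ (just false ∷_))) (total-neg (f ∘ (just true ∷_))))
  (xor-comm (total (f ∘ (just false ∷_))) _)

-- A vector with exactly one zero entry is a facet of exactly two vectors without zeros.
total-∂ : ∀ {n} (f : SignVec n → Bool) → total (∂ f) ≡ false
total-∂ {zero}  f = refl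
total-∂ {suc n} f = trans (cong₂ _xor_ (half true) (half false)) (xor-same s)
  where
  s = total (f ∘ (nothing ∷_))
  half : ∀ b → total (∂ f ∘ (just b ∷_)) ≡ s
  half b = trans (total-xor (f ∘ (nothing ∷_)) (∂ (f ∘ (just b ∷_))))
    (trans (cong (s xor_) (total-∂ (f ∘ (just b ∷_)))) (xor-identityʳ s))

-- By antipodality only the vectors starting with + matter; the sum of their faces
-- reduces to the faces starting with 0, since all others occur twice.
total-tower : ∀ {n} (a : ℕ → SignVec n → Bool) → (∀ x → a 0 x ≡ true) →
              (∀ d x → a (suc d) x xor a (suc d) (neg x) ≡ ∂ (a d) x) →
              total (a n) ≡ true
total-tower {zero}  a a₀ step = a₀ []
total-tower {suc n} a a₀ step = begin
  total plus xor total (a (suc n) ∘ (just false ∷_))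
    ≡⟨ cong (total plus xor_) (total-neg (a (suc n) ∘ (just false ∷_))) ⟨
  total plus xor total (a (suc n) ∘ (just false ∷_) ∘ neg)
    ≡⟨ total-xor plus (a (suc n) ∘ (just false ∷_) ∘ neg) ⟨
  total (λ x → plus x xor a (suc n) (neg (just true ∷ x)))
    ≡⟨ total-cong (step n ∘ (just true ∷_)) ⟩
  total (λ x → a n (nothing ∷ x) xor ∂ (a n ∘ (just true ∷_)) x)
    ≡⟨ total-xor (a n ∘ (nothing ∷_)) (∂ (a n ∘ (just true ∷_))) ⟩
  total (a n ∘ (nothing ∷_)) xor total (∂ (a n ∘ (just true ∷_)))
    ≡⟨ cong₂ _xor_ (total-tower (λ d → a d ∘ (nothing ∷_)) (a₀ ∘ (nothing ∷_))
                                (λ d → step d ∘ (nothing ∷_)))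
                   (total-∂ (a n ∘ (just true ∷_))) ⟩
  true ∎
  where
  open ≡-Reasoning
  plus = a (suc n) ∘ (just true ∷_)

total-true⇒∃ : ∀ {n} (f : SignVec n → Bool) → total f ≡ true → ∃ λ x → f x ≡ true
total-true⇒∃ {zero}  f eq = [] , eq
total-true⇒∃ {suc n} f eq with total (f ∘ (just true ∷_)) in p
... | true  = let x , fx = total-true⇒∃ (f ∘ (just true ∷_)) p in _ , fx
... | false = let x , fx = total-true⇒∃ (f ∘ (just false ∷_)) eq in _ , fx

<ᵇ-xor-<ᵇ : ∀ {k l} → k ≢ l → (k <ᵇ l) xor (l <ᵇ k) ≡ true
<ᵇ-xor-<ᵇ {zero}  {zero}  k≢l = contradiction refl k≢l
<ᵇ-xor-<ᵇ {zero}  {suc l} k≢l = refl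
<ᵇ-xor-<ᵇ {suc k} {zero}  k≢l = refl
<ᵇ-xor-<ᵇ {suc k} {suc l} k≢l = <ᵇ-xor-<ᵇ (k≢l ∘ cong suc)

-- Tucker's lemma for the labelling of x by the sign b that maximises h b x and the
-- absolute value h b x.  Along a chain with alternating signs the absolute values
-- increase strictly, so a chain of length n yields a label of absolute value ≥ n.
module Tucker {n} (h : Bool → SignVec n → ℕ)
  (h-neg  : ∀ b x → h b (neg x) ≡ h (not b) x)
  (h-mono : ∀ b {x y} → y ⋖ x → h b y ≤ h b x)
  (h-≢    : ∀ b {x y} → y ⋖ x → h b x ≢ h (not b) x)
  where

  sign : ℕ → Bool
  sign zero    = true
  sign (suc d) = not (sign d)

  -- For x with d nonzero entries: the parity of the number of maximal chains
  -- x₁ ⋖ … ⋖ x_d = x in which xᵢ has label sign (sign (i − 1)).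
  chains : ℕ → SignVec n → Bool
  chains zero    x = true
  chains (suc d) x = (h (not (sign d)) x <ᵇ h (sign d) x) ∧ ∂ (chains d) x

  h-not-not : ∀ b x → h (not (not b)) x ≡ h b x
  h-not-not b x = cong (λ c → h c x) (not-involutive b)

  mutual
    -- For positive d, `chains-step` one level down makes the sum of `chains d` and its antipode a
    -- boundary, which `∂-∂` kills.
    ∂-antipodal : ∀ d x → ∂ (chains d) (neg x) ≡ ∂ (chains d) x
    ∂-antipodal d x = xor≡false⇒≡ (begin
      ∂ (chains d) (neg x) xor ∂ (chains d) x
        ≡⟨ cong (_xor ∂ (chains d) x) (∂-neg (chains d) x) ⟩
      ∂ (chains d ∘ neg) x xor ∂ (chains d) x
        ≡⟨ ∂-xor (chains d ∘ neg) (chains d) x ⟨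
      ∂ (λ y → chains d (neg y) xor chains d y) x
        ≡⟨ ∂-cong (λ y → xor-comm (chains d (neg y)) (chains d y)) x ⟩
      ∂ (λ y → chains d y xor chains d (neg y)) x
        ≡⟨ vanish d ⟩
      false ∎)
      where
      open ≡-Reasoning
      xor≡false⇒≡ : ∀ {p q} → p xor q ≡ false → p ≡ q
      xor≡false⇒≡ {true}  {true}  _ = refl
      xor≡false⇒≡ {false} {false} _ = refl

      vanish : ∀ d → ∂ (λ y → chains d y xor chains d (neg y)) x ≡ false
      vanish zero    = trans (∂-xor (λ _ → true) (λ _ → true) x) (xor-same (∂ (λ _ → true) x))
      vanish (suc d) = trans (∂-cong (chains-step d) x) (∂-∂ (chains d) x)

    -- The labels of x and `neg x` have opposite signs, so exactly one of the two is `sign d`.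
    chains-step : ∀ d x → chains (suc d) x xor chains (suc d) (neg x) ≡ ∂ (chains d) x
    chains-step d x = begin
      (p ∧ s) xor (q ∧ ∂ (chains d) (neg x))
        ≡⟨ cong (λ t → (p ∧ s) xor (q ∧ t)) (∂-antipodal d x) ⟩
      (p ∧ s) xor (q ∧ s)
        ≡⟨ ∧-distribʳ-xor s p q ⟨
      (p xor q) ∧ s
        ≡⟨ absorb s refl ⟩
      s ∎
      where
      open ≡-Reasoning
      b = sign d
      p = h (not b) x <ᵇ h b x
      q = h (not b) (neg x) <ᵇ h b (neg x)
      s = ∂ (chains d) x

      absorb : ∀ t → s ≡ t → (p xor q) ∧ t ≡ t
      absorb false _ = ∧-zeroʳ (p xor q)
      -- Both signs tie at the zero vector, so `h-≢` asks for some y ⋖ x; a nonzero sum over the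
      -- facets supplies one.
      absorb true  eq with _ , y⋖x , _ ← ∂-true⇒⋖ (chains d) x eq =
        trans (∧-identityʳ (p xor q)) (trans
          (cong (p xor_) (cong₂ _<ᵇ_ (trans (h-neg (not b) x) (h-not-not b x)) (h-neg b x)))
          (<ᵇ-xor-<ᵇ (h-≢ b y⋖x ∘ sym)))

  -- The winning sign at x strictly beats the other one, which by monotonicity is at least the
  -- winning value d found at y.
  chains⇒label : ∀ d x → chains (suc d) x ≡ true → suc d ≤ h (sign d) x
  chains⇒label d x cx with h (not (sign d)) x <ᵇ h (sign d) x in lt
  ... | true with y , y⋖x , cy ← ∂-true⇒⋖ (chains d) x cx =
    ≤-<-trans (below d cy) (<ᵇ⇒< _ _ (Equivalence.from T-≡ lt))
    where
    below : ∀ d → chains d y ≡ true → d ≤ h (not (sign d)) x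
    below zero    _  = z≤n
    below (suc d) cy = ≤-trans (chains⇒label d y cy)
      (≤-trans (h-mono (sign d) y⋖x) (≤-reflexive (sym (h-not-not (sign d) x))))

  tucker : ∃₂ λ b x → n ≤ h b x
  tucker
    with x , cx ← total-true⇒∃ (chains n) (total-tower chains (λ _ → refl) chains-step) =
    top n cx
    where
    top : ∀ d → chains d x ≡ true → ∃₂ λ b x → d ≤ h b x
    top zero    _  = true , x , z≤n
    top (suc d) cx = sign d , x , chains⇒label d x cx

-- Alternating runs and the sides of a sign vector.

-- The length of a longest alternating subsequence of ((−1)ⁱ xᵢ) that starts with sign b,
-- where i counts from 0 at the head.
run : ∀ {n} → Bool → SignVec n → ℕ
run b     []               = 0
run b     (nothing    ∷ x) = run (not b) x
run true  (just true  ∷ x) = suc (run true x)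
run true  (just false ∷ x) = run false x
run false (just true  ∷ x) = run true x
run false (just false ∷ x) = suc (run false x)

run-neg : ∀ {n} b (x : SignVec n) → run b (neg x) ≡ run (not b) x
run-neg b     []               = refl
run-neg b     (nothing    ∷ x) = run-neg (not b) x
run-neg true  (just true  ∷ x) = run-neg false x
run-neg true  (just false ∷ x) = cong suc (run-neg true x)
run-neg false (just true  ∷ x) = cong suc (run-neg false x)
run-neg false (just false ∷ x) = run-neg true x

-- Deleting the first term of a run that starts with `not b` leaves one that starts with b.
run-not : ∀ {n} b (x : SignVec n) → run (not b) x ≤ suc (run b x)
run-not b     []               = z≤n
run-not b     (nothing    ∷ x) = run-not (not b) x
run-not true  (just true  ∷ x) = m≤n⇒m≤1+n (n≤1+n _)
run-not true  (just false ∷ x) = ≤-refl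
run-not false (just true  ∷ x) = ≤-refl
run-not false (just false ∷ x) = m≤n⇒m≤1+n (n≤1+n _)

run-mono : ∀ {n} b {x y : SignVec n} → y ⋖ x → run b y ≤ run b x
run-mono true  (drop {b = true}  {x}) = run-not true x
run-mono true  (drop {b = false})     = ≤-refl
run-mono false (drop {b = true})      = ≤-refl
run-mono false (drop {b = false} {x}) = run-not false x
run-mono b     (keep {c = nothing}    y⋖x) = run-mono (not b) y⋖x
run-mono true  (keep {c = just true}  y⋖x) = s≤s (run-mono true y⋖x)
run-mono true  (keep {c = just false} y⋖x) = run-mono false y⋖x
run-mono false (keep {c = just true}  y⋖x) = run-mono true y⋖x
run-mono false (keep {c = just false} y⋖x) = s≤s (run-mono false y⋖x)

-- The first nonzero entry, which exists because y ⋖ x, starts the longer run; the rest of that run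
-- is as long as the other one.
run-≢ : ∀ {n} b {x y : SignVec n} → y ⋖ x → run b x ≢ run (not b) x
run-≢ b     {nothing    ∷ x} (keep y⋖x) = run-≢ (not b) y⋖x
run-≢ true  {just true  ∷ x} _          = 1+n≢n
run-≢ true  {just false ∷ x} _          = 1+n≢n ∘ sym
run-≢ false {just true  ∷ x} _          = 1+n≢n ∘ sym
run-≢ false {just false ∷ x} _          = 1+n≢n

hasSign : Bool → Maybe Bool → Bool
hasSign b     nothing      = false
hasSign true  (just c)     = c
hasSign false (just c)     = not c

side : ∀ {n} → Bool → SignVec n → Subset n
side b = Vec.map (hasSign b)

side-neg : ∀ {n} b (x : SignVec n) → side b (neg x) ≡ side (not b) x
side-neg b     []               = refl
side-neg b     (nothing ∷ x) = cong (false ∷_) (side-neg b x)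
side-neg true  (just c ∷ x)  = cong (not c ∷_) (side-neg true x)
side-neg false (just true ∷ x)  = cong (true ∷_) (side-neg false x)
side-neg false (just false ∷ x) = cong (false ∷_) (side-neg false x)

side-mono : ∀ {n} b {x y : SignVec n} → y ⋖ x → side b y ⊆ side b x
side-mono b drop       = out⊆ id
side-mono b (keep y⋖x) = s⊆s (side-mono b y⋖x)

side-disjoint : ∀ {n} b (x : SignVec n) {i} → i ∈ side b x → ¬ i ∈ side (not b) x
side-disjoint b     (nothing ∷ x)    (there i∈) (there i∈′) = side-disjoint b x i∈ i∈′
side-disjoint true  (just true ∷ x)  (there i∈) (there i∈′) = side-disjoint true x i∈ i∈′
side-disjoint true  (just false ∷ x) (there i∈) (there i∈′) = side-disjoint true x i∈ i∈′
side-disjoint false (just true ∷ x)  (there i∈) (there i∈′) = side-disjoint false x i∈ i∈′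
side-disjoint false (just false ∷ x) (there i∈) (there i∈′) = side-disjoint false x i∈ i∈′

-- Weighted runs and consecutive pairs.

-- The run counted by run b x, with its positive entries of x counted three times.
weight : ∀ {n} → Bool → SignVec n → ℕ
weight b     []               = 0
weight b     (nothing    ∷ x) = weight (not b) x
weight true  (just true  ∷ x) = 3 + weight true x
weight true  (just false ∷ x) = weight false x
weight false (just true  ∷ x) = weight true x
weight false (just false ∷ x) = 1 + weight false x

-- Negation keeps the run and exchanges the weights 1 and 3 of its terms.
weight-neg : ∀ {n} b (x : SignVec n) → weight b x + weight (not b) (neg x) ≡ 4 * run b x
weight-neg b     []               = refl
weight-neg b     (nothing    ∷ x) = weight-neg (not b) x
weight-neg true  (just false ∷ x) = weight-neg false x
weight-neg false (just true  ∷ x) = weight-neg true x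
weight-neg true  (just true  ∷ x) = trans (lemma (weight true x) (weight false (neg x)))
  (trans (cong (4 +_) (weight-neg true x)) (sym (*-suc 4 (run true x))))
  where
  lemma : ∀ p q → 3 + p + (1 + q) ≡ 4 + (p + q)
  lemma = solve-∀
weight-neg false (just false ∷ x) = trans (lemma (weight false x) (weight true (neg x)))
  (trans (cong (4 +_) (weight-neg false x)) (sym (*-suc 4 (run false x))))
  where
  lemma : ∀ p q → 1 + p + (3 + q) ≡ 4 + (p + q)
  lemma = solve-∀

-- Each term of the run counts 1, and 2 more if it is positive.
weight≤ : ∀ {n} b (x : SignVec n) → weight b x ≤ run b x + 2 * ∣ side true x ∣
weight≤ b     []               = z≤n
weight≤ b     (nothing    ∷ x) = weight≤ (not b) x
weight≤ true  (just true  ∷ x) = ≤-trans (+-monoʳ-≤ 3 (weight≤ true x))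
  (≤-reflexive (lemma (run true x) ∣ side true x ∣))
  where
  lemma : ∀ r s → 3 + (r + 2 * s) ≡ 1 + r + 2 * (1 + s)
  lemma = solve-∀
weight≤ true  (just false ∷ x) = weight≤ false x
weight≤ false (just true  ∷ x) = ≤-trans (weight≤ true x)
  (+-monoʳ-≤ (run true x) (*-monoʳ-≤ 2 (n≤1+n _)))
weight≤ false (just false ∷ x) = s≤s (weight≤ false x)

-- The excess in `gap⁻` and `gap⁺`: a positive last entry has no entry after it to absorb part of
-- its weight.
end : ∀ {n} → SignVec n → ℕ
end []               = 0
end (c ∷ [])    = if hasSign true c then 1 else 0
end (c ∷ d ∷ x) = end (d ∷ x)

end-∷ : ∀ {n} c (x : SignVec n) → end x ≤ end (c ∷ x)
end-∷ c []      = z≤n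
end-∷ c (_ ∷ _) = ≤-refl

Last : ∀ {n} → Subset n → Set
Last {n} s = ∃ λ j → j ∈ s × suc (toℕ j) ≡ n

end-last : ∀ {n} (x : SignVec n) → end x ≡ 0 ⊎ end x ≡ 1 × Last (side true x)
end-last []                = inj₁ refl
end-last (nothing ∷ [])    = inj₁ refl
end-last (just true ∷ [])  = inj₂ (refl , Fin.zero , here , refl)
end-last (just false ∷ []) = inj₁ refl
end-last (c ∷ d ∷ x)       = Sum.map₂
  (λ { (eq , j , j∈ , last) → eq , Fin.suc j , there j∈ , cong suc last }) (end-last (d ∷ x))

Adjacent : ∀ {n} → Subset n → Set
Adjacent s = ∃₂ λ i j → i ∈ s × j ∈ s × toℕ j ≡ suc (toℕ i)

adjacent-∷ : ∀ {n b} {s : Subset n} → Adjacent s → Adjacent (b ∷ s)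
adjacent-∷ (i , j , i∈ , j∈ , eq) = Fin.suc i , Fin.suc j , there i∈ , there j∈ , cong suc eq

-- Consecutive terms of a run lie at odd distance if their signs in x agree and at even
-- distance if they differ; distance 1 between positive terms is what Adjacent excludes.
-- gap⁻ and gap⁺ also apply after a negative term, or after a positive term and one
-- entry, respectively.
mutual
  gap⁻ : ∀ {n} (x : SignVec n) → Adjacent (side true x) ⊎ weight false x ≤ n + end x
  gap⁻ []               = inj₂ z≤n
  gap⁻ {suc n} (nothing    ∷ x) = Sum.map adjacent-∷
    (λ le → ≤-trans le (+-monoʳ-≤ (suc n) (end-∷ _ x))) (gap⁺ x)
  gap⁻ {suc n} (just true  ∷ x) = Sum.map adjacent-∷
    (λ le → ≤-trans le (+-monoʳ-≤ (suc n) (end-∷ _ x))) (gap⁺ x)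
  gap⁻ {suc n} (just false ∷ x) = Sum.map adjacent-∷
    (λ le → s≤s (≤-trans le (+-monoʳ-≤ n (end-∷ _ x)))) (gap⁻ x)

  gap⁺ : ∀ {n} (x : SignVec n) → Adjacent (side true x) ⊎ weight true x ≤ suc n + end x
  gap⁺ []               = inj₂ z≤n
  gap⁺ {suc n} (nothing ∷ x) = Sum.map adjacent-∷
    (λ le → m≤n⇒m≤1+n (m≤n⇒m≤1+n (≤-trans le (+-monoʳ-≤ n (end-∷ _ x))))) (gap⁻ x)
  gap⁺ {suc n} (just false ∷ x) = Sum.map adjacent-∷
    (λ le → m≤n⇒m≤1+n (m≤n⇒m≤1+n (≤-trans le (+-monoʳ-≤ n (end-∷ _ x))))) (gap⁻ x)
  gap⁺ (just true ∷ []) = inj₂ ≤-refl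
  gap⁺ (just true ∷ just true ∷ x) =
    inj₁ (Fin.zero , Fin.suc Fin.zero , here , there here , refl)
  gap⁺ {suc (suc n)} (just true ∷ nothing ∷ x) = Sum.map (adjacent-∷ ∘ adjacent-∷)
    (λ le → +-monoʳ-≤ 3 (≤-trans le (+-monoʳ-≤ n (end-∷ _ x)))) (gap⁻ x)
  gap⁺ {suc (suc n)} (just true ∷ just false ∷ x) = Sum.map (adjacent-∷ ∘ adjacent-∷)
    (λ le → +-monoʳ-≤ 3 (≤-trans le (+-monoʳ-≤ n (end-∷ _ x)))) (gap⁻ x)

adjacent⇒consecutive : ∀ {n} {s : Subset n} → Adjacent s → ContainsConsecutive s
adjacent⇒consecutive (i , j , i∈ , j∈ , eq) = i , j , i∈ , j∈ , inj₁ eq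

-- One unit of excess over n may arise at the start and one at the end, and only one is allowed.
-- Both are needed only if the first and last entries are positive, and these form the pair {1, n}.
gap : ∀ {n} b (x : SignVec n) →
      ContainsConsecutive (side true x) ⊎ weight b x ≤ suc n
gap {n} b x with end-last x
gap {n} true x | inj₁ eq = Sum.map adjacent⇒consecutive
  (λ le → ≤-trans le (≤-reflexive (trans (cong (suc n +_) eq) (+-identityʳ (suc n))))) (gap⁺ x)
gap {n} false x | inj₁ eq = Sum.map adjacent⇒consecutive
  (λ le → ≤-trans le (≤-trans (≤-reflexive (trans (cong (n +_) eq) (+-identityʳ n))) (n≤1+n n)))
  (gap⁻ x)
gap {n} false x | inj₂ (eq , _) = Sum.map adjacent⇒consecutive
  (λ le → ≤-trans le (≤-reflexive (trans (cong (n +_) eq) (+-comm n 1)))) (gap⁻ x)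
gap true (just true ∷ x) | inj₂ (_ , j , j∈ , last) =
  inj₁ (Fin.zero , j , here , j∈ , inj₂ (refl , last))
gap {suc n} true (nothing ∷ x) | inj₂ (eq , _) = Sum.map (adjacent⇒consecutive ∘ adjacent-∷)
  (λ le → ≤-trans le (≤-trans (+-monoʳ-≤ n (≤-trans (end-∷ _ x) (≤-reflexive eq)))
    (≤-trans (≤-reflexive (+-comm n 1)) (n≤1+n _)))) (gap⁻ x)
gap {suc n} true (just false ∷ x) | inj₂ (eq , _) = Sum.map (adjacent⇒consecutive ∘ adjacent-∷)
  (λ le → ≤-trans le (≤-trans (+-monoʳ-≤ n (≤-trans (end-∷ _ x) (≤-reflexive eq)))
    (≤-trans (≤-reflexive (+-comm n 1)) (n≤1+n _)))) (gap⁻ x)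

-- With p positive terms in a run of length r the weight is r + 2p, so the last hypothesis says that
-- at least half of the terms are positive.
heavy-side : ∀ {n} R b (x : SignVec n) → n ≤ 2 * R → R < run b x → 2 * run b x ≤ weight b x →
             R < 2 * ∣ side true x ∣ × ContainsConsecutive (side true x)
heavy-side {n} R b x n≤2R R<r 2r≤w =
  size , [ id , (λ w≤ → contradiction w≤ (<⇒≱ n<w)) ]′ (gap b x)
  where
  r = run b x

  size : R < 2 * ∣ side true x ∣
  size = <-≤-trans R<r (+-cancelˡ-≤ r r _ (begin
    r + r                     ≡⟨ cong (r +_) (+-identityʳ r) ⟨
    2 * r                     ≤⟨ 2r≤w ⟩
    weight b x                ≤⟨ weight≤ b x ⟩
    r + 2 * ∣ side true x ∣ ∎))
    where open ≤-Reasoning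

  n<w : suc n < weight b x
  n<w = begin
    2 + n         ≤⟨ +-monoʳ-≤ 2 n≤2R ⟩
    2 + 2 * R     ≡⟨ *-suc 2 R ⟨
    2 * suc R     ≤⟨ *-monoʳ-≤ 2 R<r ⟩
    2 * r         ≤⟨ 2r≤w ⟩
    weight b x ∎
    where open ≤-Reasoning

-- By `weight-neg` the weights for x and `neg x` add up to 4r, so one of them is at least 2r.
unstable-side : ∀ {n} R b (x : SignVec n) → n ≤ 2 * R → R < run b x →
                ∃ λ c → R < 2 * ∣ side c x ∣ × ContainsConsecutive (side c x)
unstable-side R b x n≤2R R<r with ≤-total (2 * run b x) (weight b x)
... | inj₁ 2r≤w = true , heavy-side R b x n≤2R R<r 2r≤w
... | inj₂ w≤2r = false , subst (λ s → R < 2 * ∣ s ∣ × ContainsConsecutive s) (side-neg true x)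
  (heavy-side R (not b) (neg x) n≤2R (subst (R <_) (sym run≡) R<r)
    (subst (λ r → 2 * r ≤ weight (not b) (neg x)) (sym run≡) 2r≤w′))
  where
  r = run b x

  run≡ : run (not b) (neg x) ≡ r
  run≡ = trans (run-neg (not b) x) (cong (λ c → run c x) (not-involutive b))

  2r≤w′ : 2 * r ≤ weight (not b) (neg x)
  2r≤w′ = +-cancelˡ-≤ (2 * r) _ _ (begin
    2 * r + 2 * r                       ≡⟨ *-distribʳ-+ r 2 2 ⟨
    4 * r                               ≡⟨ weight-neg b x ⟨
    weight b x + weight (not b) (neg x) ≤⟨ +-monoˡ-≤ _ w≤2r ⟩
    2 * r + weight (not b) (neg x)      ∎)
    where open ≤-Reasoning

-- Sizes of subsets, parity and colourings by numbers.

between : ∀ {n k} (p s : Subset n) → p ⊆ s → ∣ p ∣ ≤ k → k ≤ ∣ s ∣ →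
          ∃ λ t → p ⊆ t × t ⊆ s × ∣ t ∣ ≡ k
between []          []          p⊆s z≤n z≤n = [] , id , id , refl
between (true  ∷ p) (false ∷ s) p⊆s _ _ with () ← p⊆s here
between (true  ∷ p) (true  ∷ s) p⊆s (s≤s p≤k) (s≤s k≤s) =
  let t , p⊆t , t⊆s , eq = between p s (drop-∷-⊆ p⊆s) p≤k k≤s
  in true ∷ t , s⊆s p⊆t , s⊆s t⊆s , cong suc eq
between (false ∷ p) (false ∷ s) p⊆s p≤k k≤s =
  let t , p⊆t , t⊆s , eq = between p s (drop-∷-⊆ p⊆s) p≤k k≤s
  in false ∷ t , s⊆s p⊆t , s⊆s t⊆s , eq
between (false ∷ p) (true  ∷ s) p⊆s p≤k k≤1+s with m≤n⇒m<n∨m≡n k≤1+s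
... | inj₂ refl      = true ∷ s , p⊆s , id , refl
... | inj₁ (s≤s k≤s) =
  let t , p⊆t , t⊆s , eq = between p s (drop-∷-⊆ p⊆s) p≤k k≤s
  in false ∷ t , s⊆s p⊆t , out⊆ t⊆s , eq

∣p∪q∣≤∣p∣+∣q∣ : ∀ {n} (p q : Subset n) → ∣ p ∪ q ∣ ≤ ∣ p ∣ + ∣ q ∣
∣p∪q∣≤∣p∣+∣q∣ []          []          = z≤n
∣p∪q∣≤∣p∣+∣q∣ (false ∷ p) (false ∷ q) = ∣p∪q∣≤∣p∣+∣q∣ p q
∣p∪q∣≤∣p∣+∣q∣ (true  ∷ p) (false ∷ q) = s≤s (∣p∪q∣≤∣p∣+∣q∣ p q)
∣p∪q∣≤∣p∣+∣q∣ (false ∷ p) (true  ∷ q) =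
  ≤-trans (s≤s (∣p∪q∣≤∣p∣+∣q∣ p q)) (≤-reflexive (sym (+-suc ∣ p ∣ ∣ q ∣)))
∣p∪q∣≤∣p∣+∣q∣ (true  ∷ p) (true  ∷ q) =
  s≤s (≤-trans (∣p∪q∣≤∣p∣+∣q∣ p q) (+-monoʳ-≤ ∣ p ∣ (n≤1+n ∣ q ∣)))

disjoint-above : ∀ {n} d (s t : Subset n) → Disjoint s t → d ≤ n →
                 (∀ {i} → i ∈ s → d ≤ toℕ i) → (∀ {i} → i ∈ t → d ≤ toℕ i) →
                 d + (∣ s ∣ + ∣ t ∣) ≤ n
disjoint-above zero    []          []          _     _         _   _   = z≤n
disjoint-above zero    (true ∷ s)  (true ∷ t)  s∩t=∅ _         _   _   =
  contradiction (Fin.zero , here) s∩t=∅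
disjoint-above zero    (true ∷ s)  (false ∷ t) s∩t=∅ _         s≥d t≥d =
  s≤s (disjoint-above 0 s t (drop-∷-Empty s∩t=∅) z≤n (λ _ → z≤n) (λ _ → z≤n))
disjoint-above zero    (false ∷ s) (true ∷ t)  s∩t=∅ _         s≥d t≥d =
  ≤-trans (≤-reflexive (+-suc ∣ s ∣ ∣ t ∣))
    (s≤s (disjoint-above 0 s t (drop-∷-Empty s∩t=∅) z≤n (λ _ → z≤n) (λ _ → z≤n)))
disjoint-above zero    (false ∷ s) (false ∷ t) s∩t=∅ _         s≥d t≥d =
  m≤n⇒m≤1+n (disjoint-above 0 s t (drop-∷-Empty s∩t=∅) z≤n (λ _ → z≤n) (λ _ → z≤n))
disjoint-above (suc d) (true ∷ s)  t           _     _         s≥d _   =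
  contradiction (s≥d here) λ ()
disjoint-above (suc d) (false ∷ s) (true ∷ t)  _     _         _   t≥d =
  contradiction (t≥d here) λ ()
disjoint-above (suc d) (false ∷ s) (false ∷ t) s∩t=∅ (s≤s d≤n) s≥d t≥d =
  s≤s (disjoint-above d s t (drop-∷-Empty s∩t=∅) d≤n
    (λ i∈ → s≤s⁻¹ (s≥d (there i∈))) (λ i∈ → s≤s⁻¹ (t≥d (there i∈))))

-- Selects the even member of a pair of successive positions in `colorable-by-cover`.
even-or-odd : ∀ m → (∃ λ c → m ≡ c + c) ⊎ (∃ λ c → suc m ≡ c + c)
even-or-odd zero    = inj₁ (0 , refl)
even-or-odd (suc m) with even-or-odd m
... | inj₁ (c , eq) = inj₂ (suc c , cong suc (trans (cong suc eq) (sym (+-suc c c))))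
... | inj₂ even     = inj₁ even

colorableByℕ : ∀ {G m} → let open FiniteGraph G in
  (c : V → ℕ) → (∀ v → c v < m) → (∀ {u v} → u ~ v → c u ≢ c v) → Colorable G m
colorableByℕ c c<m proper =
  (λ v → fromℕ< (c<m v)) , λ u~v eq → proper u~v (fromℕ<-injective _ _ (c<m _) (c<m _) eq)

-- The lower bound: a Tucker labelling from a colouring.

module _ {n k : ℕ} where
  open FiniteGraph (U n k)

  -- The consecutive pair has at most 2 ≤ k elements, so it extends to a k-subset of s.
  vertex⊆ : ∀ {s} → 2 ≤ k → k ≤ ∣ s ∣ → ContainsConsecutive s → ∃ λ (v : V) → value v ⊆ s
  vertex⊆ {s} 2≤k k≤s (i , j , i∈s , j∈s , consecutive) = (t , [ isVertex ]) , t⊆s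
    where
    pair⊆s : ⁅ i ⁆ ∪ ⁅ j ⁆ ⊆ s
    pair⊆s x∈ with x∈p∪q⁻ ⁅ i ⁆ ⁅ j ⁆ x∈
    ... | inj₁ x∈i rewrite x∈⁅y⁆⇒x≡y i x∈i = i∈s
    ... | inj₂ x∈j rewrite x∈⁅y⁆⇒x≡y j x∈j = j∈s

    ∣pair∣≤2 : ∣ ⁅ i ⁆ ∪ ⁅ j ⁆ ∣ ≤ 2
    ∣pair∣≤2 = ≤-trans (∣p∪q∣≤∣p∣+∣q∣ ⁅ i ⁆ ⁅ j ⁆)
      (≤-reflexive (cong₂ _+_ (∣⁅x⁆∣≡1 i) (∣⁅x⁆∣≡1 j)))

    subset = between (⁅ i ⁆ ∪ ⁅ j ⁆) s pair⊆s (≤-trans ∣pair∣≤2 2≤k) k≤s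
    t      = proj₁ subset
    pair⊆t = proj₁ (proj₂ subset)
    t⊆s    = proj₁ (proj₂ (proj₂ subset))
    size   = proj₂ (proj₂ (proj₂ subset))

    isVertex : IsVertex n k t
    isVertex = size , i , j , pair⊆t (x∈p∪q⁺ (inj₁ (x∈⁅x⁆ i))) ,
      pair⊆t (x∈p∪q⁺ (inj₂ (x∈⁅x⁆ j))) , consecutive

  module Labelling {m} (colour : V → Fin m) (proper : ∀ {u v} → u ~ v → colour u ≢ colour v)
    (R : ℕ) (2≤k : 2 ≤ k) (2k≤2+R : 2 * k ≤ 2 + R) (n≤2R : n ≤ 2 * R) where

    -- Levels exceed R, so top r s is r ⊓ R exactly when no vertex is contained in s.
    level : V → ℕ
    level v = suc (R + toℕ (colour v))

    inside : Subset n → List V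
    inside s = filter (λ v → value v ⊆? s) vertices

    ∈-inside : ∀ {s} (v : V) → value v ⊆ s → v ∈ᴸ inside s
    ∈-inside v v⊆s = ∈-filter⁺ (λ v → value v ⊆? _) (complete v) v⊆s

    top : ℕ → Subset n → ℕ
    top r s = max (r ⊓ R) (List.map level (inside s))

    top-sel : ∀ r s → (top r s ≡ r ⊓ R) ⊎ ∃ λ (v : V) → value v ⊆ s × top r s ≡ level v
    top-sel r s = Sum.map₂ found (argmax-sel id (r ⊓ R) (List.map level (inside s)))
      where
      found : top r s ∈ᴸ List.map level (inside s) → _
      found top∈ =
        let v , v∈ , eq = ∈-map⁻ level top∈
        in v , proj₂ (∈-filter⁻ (λ v → value v ⊆? s) {xs = vertices} v∈) , eq

    level≤top : ∀ r {s} (v : V) → value v ⊆ s → level v ≤ top r s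
    level≤top r v v⊆s = All.lookup (xs≤max (r ⊓ R) _) (∈-map⁺ level (∈-inside v v⊆s))

    top-mono : ∀ {r q s t} → r ≤ q → s ⊆ t → top r s ≤ top q t
    top-mono {s = s} {t} r≤q s⊆t = max-mono-⊆ (⊓-monoˡ-≤ R r≤q)
      (map⁺ level (filter⁺′ (λ v → value v ⊆? s) (λ v → value v ⊆? t)
        (λ v⊆s → ⊆-trans v⊆s s⊆t) {xs = vertices} id))

    top≤ : ∀ r s → top r s ≤ R + m
    top≤ r s with top-sel r s
    ... | inj₁ eq rewrite eq = ≤-trans (m⊓n≤n r R) (m≤m+n R m)
    ... | inj₂ (v , _ , eq) rewrite eq | sym (+-suc R (toℕ (colour v))) =
      +-monoʳ-≤ R (toℕ<n (colour v))

    h : Bool → SignVec n → ℕ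
    h b x = top (run b x) (side b x)

    h-neg : ∀ b x → h b (neg x) ≡ h (not b) x
    h-neg b x = cong₂ top (run-neg b x) (side-neg b x)

    h-mono : ∀ b {x y} → y ⋖ x → h b y ≤ h b x
    h-mono b y⋖x = top-mono (run-mono b y⋖x) (side-mono b y⋖x)

    -- A longer run would put a vertex in a side given by `unstable-side`, which may be either one;
    -- hence the hypothesis on both.
    run≤R : ∀ {x} → (∀ c (v : V) → ¬ value v ⊆ side c x) → ∀ b → run b x ≤ R
    run≤R {x} none b = ≮⇒≥ λ R<r →
      let c , R<2s , cc = unstable-side R b x n≤2R R<r
          v , v⊆s = vertex⊆ 2≤k (k≤ R<2s) cc
      in none c v v⊆s
      where
      k≤ : ∀ {s} → R < 2 * s → k ≤ s
      k≤ {s} R<2s = ≮⇒≥ λ s<k → <⇒≱ R<2s (+-cancelˡ-≤ 2 _ _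
        (≤-trans (≤-reflexive (sym (*-suc 2 s))) (≤-trans (*-monoʳ-≤ 2 s<k) 2k≤2+R)))

    Attained : Bool → SignVec n → Set
    Attained b x = (h b x ≡ run b x ⊓ R) ⊎ ∃ λ (v : V) → value v ⊆ side b x × h b x ≡ level v

    ⊓R<level : ∀ r v → r ⊓ R < level v
    ⊓R<level r v = s≤s (≤-trans (m⊓n≤n r R) (m≤m+n R (toℕ (colour v))))

    -- Two levels belong to disjoint, hence adjacent, vertices; a level exceeds any capped run; if
    -- both values are capped runs, no side contains a vertex, so the cap is inactive and `run-≢`
    -- applies.
    attained-≢ : ∀ b {x y} → y ⋖ x → Attained b x → Attained (not b) x → h b x ≢ h (not b) x
    attained-≢ b {x} y⋖x (inj₂ (u , u⊆ , p)) (inj₂ (v , v⊆ , q)) eq =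
      proper (λ (i , i∈) → let i∈u , i∈v = x∈p∩q⁻ (value u) (value v) i∈
                           in side-disjoint b x (u⊆ i∈u) (v⊆ i∈v))
        (toℕ-injective (+-cancelˡ-≡ R _ _ (suc-injective (trans (sym p) (trans eq q)))))
    attained-≢ b {x} y⋖x (inj₁ p) (inj₂ (v , _ , q)) eq =
      <⇒≢ (⊓R<level (run b x) v) (trans (sym p) (trans eq q))
    attained-≢ b {x} y⋖x (inj₂ (u , _ , p)) (inj₁ q) eq =
      <⇒≢ (⊓R<level (run (not b) x) u) (trans (sym q) (trans (sym eq) p))
    attained-≢ b {x} y⋖x (inj₁ p) (inj₁ q) eq = run-≢ b y⋖x (begin
      run b x           ≡⟨ m≤n⇒m⊓n≡m (run≤R none b) ⟨
      run b x ⊓ R       ≡⟨ trans (sym p) (trans eq q) ⟩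
      run (not b) x ⊓ R ≡⟨ m≤n⇒m⊓n≡m (run≤R none (not b)) ⟩
      run (not b) x ∎)
      where
      open ≡-Reasoning
      h≤R : ∀ c → h c x ≤ R
      h≤R c with c Bool.≟ b
      ... | yes refl = ≤-trans (≤-reflexive p) (m⊓n≤n (run b x) R)
      ... | no  c≢b  = subst (λ c → h c x ≤ R) (sym (¬-not c≢b))
        (≤-trans (≤-reflexive q) (m⊓n≤n (run (not b) x) R))
      none : ∀ c (v : V) → ¬ value v ⊆ side c x
      none c v v⊆ = <⇒≱ (s≤s (m≤m+n R _)) (≤-trans (level≤top (run c x) v v⊆) (h≤R c))

    h-≢ : ∀ b {x y} → y ⋖ x → h b x ≢ h (not b) x
    h-≢ b {x} y⋖x = attained-≢ b y⋖x (top-sel (run b x) (side b x))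
                                     (top-sel (run (not b) x) (side (not b) x))

    order≤ : n ≤ R + m
    order≤ =
      let b , x , n≤h = Tucker.tucker h h-neg h-mono h-≢
      in ≤-trans n≤h (top≤ (run b x) (side b x))

  chromatic-lower : ∀ {m} → 2 ≤ k → n ≥ 2 * k → Colorable (U n k) m →
                    (n ∸ 2 * k + 2) ⊓ ⌊ n /2⌋ ≤ m
  chromatic-lower {m} 2≤k 2k≤n (colour , proper) = begin
    (n ∸ 2 * k + 2) ⊓ ⌊ n /2⌋         ≤⟨ ⊓-mono-≤ kneser cover ⟩
    -- Subtraction from n turns the maximum R into a minimum.
    (n ∸ (2 * k ∸ 2)) ⊓ (n ∸ ⌈ n /2⌉) ≡⟨ ∸-distribˡ-⊔-⊓ n (2 * k ∸ 2) ⌈ n /2⌉ ⟨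
    n ∸ R                             ≤⟨ m≤n+o⇒m∸n≤o n R order≤ ⟩
    m ∎
    where
    open ≤-Reasoning
    R = (2 * k ∸ 2) ⊔ ⌈ n /2⌉

    2≤2k : 2 ≤ 2 * k
    2≤2k = ≤-trans 2≤k (m≤m+n k _)

    kneser : n ∸ 2 * k + 2 ≤ n ∸ (2 * k ∸ 2)
    kneser = m+n≤o⇒m≤o∸n (n ∸ 2 * k + 2) (≤-reflexive (trans (+-assoc (n ∸ 2 * k) 2 _)
      (trans (cong (n ∸ 2 * k +_) (m+[n∸m]≡n 2≤2k)) (m∸n+n≡m 2k≤n))))

    cover : ⌊ n /2⌋ ≤ n ∸ ⌈ n /2⌉
    cover = m+n≤o⇒m≤o∸n ⌊ n /2⌋ (≤-reflexive (⌊n/2⌋+⌈n/2⌉≡n n))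

    n≤2R : n ≤ 2 * R
    n≤2R = begin
      n                     ≡⟨ ⌊n/2⌋+⌈n/2⌉≡n n ⟨
      ⌊ n /2⌋ + ⌈ n /2⌉     ≤⟨ +-monoˡ-≤ ⌈ n /2⌉ (⌊n/2⌋≤⌈n/2⌉ n) ⟩
      ⌈ n /2⌉ + ⌈ n /2⌉     ≤⟨ +-mono-≤ ⌈n/2⌉≤R ⌈n/2⌉≤R ⟩
      R + R                 ≡⟨ cong (R +_) (+-identityʳ R) ⟨
      2 * R ∎
      where ⌈n/2⌉≤R = m≤n⊔m (2 * k ∸ 2) ⌈ n /2⌉

    open Labelling colour proper R 2≤k
      (≤-trans (≤-reflexive (sym (m+[n∸m]≡n 2≤2k))) (+-monoʳ-≤ 2 (m≤m⊔n _ _))) n≤2R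

  -- The upper bounds: two explicit colourings.

  witness : (v : V) → IsVertex n k (value v)
  witness (s , [ v ]) = recompute (isVertex? n k s) v

  -- The even positions, counted from 0, meet every consecutive pair. Vertices of equal colour c
  -- share the element at position 2c.
  colorable-by-cover : Colorable (U n k) ⌈ n /2⌉
  colorable-by-cover = colorableByℕ {U n k} (proj₁ ∘ pick) bound proper
    where
    pick : (v : V) → ∃₂ λ c i → i ∈ value v × toℕ i ≡ c + c
    pick v with witness v
    ... | _ , i , j , i∈v , j∈v , inj₂ (i≡0 , _) = 0 , i , i∈v , i≡0
    ... | _ , i , j , i∈v , j∈v , inj₁ j≡1+i with even-or-odd (toℕ i)
    ...   | inj₁ (c , i≡2c)   = c , i , i∈v , i≡2c
    ...   | inj₂ (c , 1+i≡2c) = c , j , j∈v , trans j≡1+i 1+i≡2c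

    bound : ∀ v → proj₁ (pick v) < ⌈ n /2⌉
    bound v = let c , i , _ , i≡2c = pick v in
      -- From 2c + 2 ≤ n + 1, halving gives c + 1 ≤ ⌈n/2⌉.
      ≤-trans (≤-reflexive (cong suc (n≡⌊n+n/2⌋ c)))
        (⌊n/2⌋-mono (s≤s (subst (_< n) i≡2c (toℕ<n i))))

    proper : ∀ {u v} → u ~ v → proj₁ (pick u) ≢ proj₁ (pick v)
    proper {u} {v} u~v eq with pick u | pick v
    proper {u} {v} u~v refl | c , i , i∈u , i≡2c | .c , j , j∈v , j≡2c
      rewrite toℕ-injective (trans i≡2c (sym j≡2c)) = u~v (j , x∈p∩q⁺ (i∈u , j∈v))

  colorable-kneser : n ≥ 2 * k → Colorable (U n k) (suc (suc (n ∸ 2 * k)))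
  colorable-kneser 2k≤n = colorableByℕ {U n k} (proj₁ ∘ pick) bound proper
    where
    d = suc (n ∸ 2 * k)

    pick : (v : V) → ∃ λ c → (c < d × ∃ λ i → i ∈ value v × toℕ i ≡ c) ⊎
                             (c ≡ d × ∀ {i} → i ∈ value v → d ≤ toℕ i)
    pick v with any? (λ i → (i ∈? value v) ×-dec (toℕ i <? d))
    ... | yes (i , i∈v , i<d) = toℕ i , inj₁ (i<d , i , i∈v , refl)
    ... | no  none            = d , inj₂ (refl , λ i∈v → ≮⇒≥ λ i<d → none (_ , i∈v , i<d))

    bound : ∀ v → proj₁ (pick v) < suc d
    bound v with pick v
    ... | _ , inj₁ (c<d , _)  = m≤n⇒m≤1+n c<d
    ... | _ , inj₂ (refl , _) = ≤-refl

    proper : ∀ {u v} → u ~ v → proj₁ (pick u) ≢ proj₁ (pick v)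
    proper {u} {v} u~v eq with pick u | pick v
    proper {u} {v} u~v refl | c , inj₁ (_ , i , i∈u , i≡c) | .c , inj₁ (_ , j , j∈v , j≡c)
      rewrite toℕ-injective (trans i≡c (sym j≡c)) = u~v (j , x∈p∩q⁺ (i∈u , j∈v))
    proper u~v refl | _ , inj₁ (c<d , _)  | _ , inj₂ (refl , _) = <-irrefl refl c<d
    proper u~v refl | _ , inj₂ (refl , _) | _ , inj₁ (c<d , _)  = <-irrefl refl c<d
    proper {u} {v} u~v refl | _ , inj₂ (refl , u≥d) | _ , inj₂ (_ , v≥d)
      with ∣u∣≡k , i , _ , i∈u , _ ← witness u | ∣v∣≡k , _ ← witness v =
      <-irrefl refl (begin-strict
        n                               ≡⟨ m∸n+n≡m 2k≤n ⟨
        -- The contradiction is this one unit: d is the successor of `n ∸ 2 * k`, so only 2k - 1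
        -- elements are left for two disjoint k-sets.
        n ∸ 2 * k + 2 * k               <⟨ ≤-refl ⟩
        d + (k + (k + 0))               ≡⟨ cong (λ l → d + (k + l)) (+-identityʳ k) ⟩
        d + (k + k)                     ≡⟨ cong₂ (λ l r → d + (l + r)) ∣u∣≡k ∣v∣≡k ⟨
        d + (∣ value u ∣ + ∣ value v ∣) ≤⟨ disjoint-above d (value u) (value v) u~v
                                             (≤-trans (u≥d i∈u) (<⇒≤ (toℕ<n i))) u≥d v≥d ⟩
        n ∎)
      where open ≤-Reasoning

χ-colorable : ∀ G → Colorable G (χ G)
χ-colorable G = proj₁ (proj₂ (chromaticNumber G))

χ-least : ∀ G {m} → Colorable G m → χ G ≤ m
χ-least G = proj₂ (proj₂ (chromaticNumber G)) _

-- For k ≤ 1 and n ≥ 2k the graph has no vertices, so its chromatic number is 0 and the lower bound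
-- fails once n ≥ 2; hence 2 ≤ k there.
corollary5p5 : ∀ (n k : ℕ) → n ≥ 2 * k →
    (2 ≤ k → (n ∸ 2 * k + 2) ⊓ ⌊ n /2⌋ ≤ χ (U n k)) ×
    (χ (U n k) ≤ (n ∸ 2 * k + 2) ⊓ ⌈ n /2⌉)
corollary5p5 n k n≥2k =
  (λ 2≤k → chromatic-lower 2≤k n≥2k (χ-colorable (U n k))) ,
  ⊓-glb (≤-trans (χ-least (U n k) (colorable-kneser n≥2k)) (≤-reflexive (+-comm 2 (n ∸ 2 * k))))
        (χ-least (U n k) colorable-by-cover)
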